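{- Let $\mathcal{E}$ be the class of Kalmár elementary functions. Then $$\langle x\mathbin{\dot- }y,\ x\bmod y,\ 2^x\rangle\subsetneqq\mathcal{E}.$$
   Context: $\mathbb{N}$ is the set of non-negative integers. An ($r$-ary, $r\ge 1$) operation on $\mathbb{N}$ is a function $\mathbb{N}^r\to\mathbb{N}$. Truncated subtraction is $x \mathbin{\dot- } y:=\max(x-y,0)$. Conventions: $\lfloor x/0\rfloor:=0$, and $x\bmod y:=x \mathbin{\dot- } y\lfloor x/y\rfloor$, so that $x\bmod 0=x$. A set $S$ of operations on $\mathbb{N}$ is closed under substitution if, whenever $f\in S$ is $r$-ary and $g_1,\dots,g_r\in S$ are $n$-ary, the operation $\vec x\mapsto f(g_1(\vec x),\dots,g_r(\vec x))$ is in $S$. For a set $\mathcal{B}$ of operations on $\mathbb{N}$, $\langle\mathcal{B}\rangle$ denotes the closure under substitution of $\mathcal{B}\cup C\cup P$, where $C$ is the set of all constant operations on $\mathbb{N}$ (of every arity) and $P$ is the set of all projections $(x_1,\dots,x_n)\mapsto x_i$. Here $x\mathbin{\dot- }y$ and $x\bmod y$ denote binary operations and $2^x$ a unary operation. The Kalmár elementary functions, forming the class $\mathcal{E}$, are the elements of the smallest set of operations on $\mathbb{N}$ that contains the constants, the projections, the addition, and the truncated subtraction, and that is closed under substitution, bounded summation ($(\vec x,y)\mapsto\sum_{z<y}f(\vec x,z)$), and bounded multiplication ($(\vec x,y)\mapsto\prod_{z<y}f(\vec x,z)$). -}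

module Defs where

open import Data.Fin.Base using (Fin)
open import Data.List.Base using (applyUpTo)
open import Data.Nat.Base using (ℕ; zero; suc; _+_; _*_; _∸_; _^_; _/_)
open import Data.Nat.ListAction using (sum; product)
open import Data.Vec.Base using (Vec; []; _∷_; _∷ʳ_; init; last; lookup; tabulate)
open import Level using (0ℓ)
open import Relation.Binary.PropositionalEquality using (_≗_)
open import Relation.Unary using (Pred; _∈_)

-- Operations have arity at least 1, hence the successor.
record Operation : Set where
  constructor op
  field
    {pred-arity} : ℕ
    fun          : Vec ℕ (suc pred-arity) → ℕ

substitute : ∀ {r n} → (Vec ℕ r → ℕ) → (Fin r → Vec ℕ n → ℕ) → (Vec ℕ n → ℕ)
substitute f g xs = f (tabulate λ i → g i xs)

-- (x⃗ , y) ↦ Σ_{z<y} f (x⃗ , z); the bound y is the last argument.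
boundedSum : ∀ {n} → (Vec ℕ (suc n) → ℕ) → (Vec ℕ (suc n) → ℕ)
boundedSum f xs = sum (applyUpTo (λ z → f (init xs ∷ʳ z)) (last xs))

boundedProduct : ∀ {n} → (Vec ℕ (suc n) → ℕ) → (Vec ℕ (suc n) → ℕ)
boundedProduct f xs = product (applyUpTo (λ z → f (init xs ∷ʳ z)) (last xs))

-- ⌊ x / y ⌋, with ⌊ x / 0 ⌋ = 0.
_div_ : ℕ → ℕ → ℕ
x div zero    = 0
x div (suc y) = x / suc y

-- In particular x mod 0 = x.
_mod_ : ℕ → ℕ → ℕ
x mod y = x ∸ y * (x div y)

unary : (ℕ → ℕ) → Operation
unary f = op {0} λ { (x ∷ []) → f x }

binary : (ℕ → ℕ → ℕ) → Operation
binary f = op {1} λ { (x ∷ y ∷ []) → f x y }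

-- The constructor `ext` makes membership depend only on the values of an
-- operation: pointwise equal functions are the same operation, but without
-- function extensionality they need not be propositionally equal.
data ⟨_⟩ (B : Pred Operation 0ℓ) : Pred Operation 0ℓ where
  basis : ∀ {o} → o ∈ B → o ∈ ⟨ B ⟩
  const : ∀ {n} (c : ℕ) → op {n} (λ _ → c) ∈ ⟨ B ⟩
  proj  : ∀ {n} (i : Fin (suc n)) → op {n} (λ xs → lookup xs i) ∈ ⟨ B ⟩
  subst : ∀ {r n} {f : Vec ℕ (suc r) → ℕ} {g : Fin (suc r) → Vec ℕ (suc n) → ℕ} →
          op f ∈ ⟨ B ⟩ → (∀ i → op (g i) ∈ ⟨ B ⟩) → op (substitute f g) ∈ ⟨ B ⟩
  ext   : ∀ {n} {f g : Vec ℕ (suc n) → ℕ} → f ≗ g → op f ∈ ⟨ B ⟩ → op g ∈ ⟨ B ⟩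

data Monus-Mod-Exp : Pred Operation 0ℓ where
  monus  : binary _∸_ ∈ Monus-Mod-Exp
  modulo : binary _mod_ ∈ Monus-Mod-Exp
  exp₂   : unary (2 ^_) ∈ Monus-Mod-Exp

-- The Kalmár elementary functions; `ext` is as for ⟨_⟩.
data ℰ : Pred Operation 0ℓ where
  const : ∀ {n} (c : ℕ) → op {n} (λ _ → c) ∈ ℰ
  proj  : ∀ {n} (i : Fin (suc n)) → op {n} (λ xs → lookup xs i) ∈ ℰ
  plus  : binary _+_ ∈ ℰ
  monus : binary _∸_ ∈ ℰ
  subst : ∀ {r n} {f : Vec ℕ (suc r) → ℕ} {g : Fin (suc r) → Vec ℕ (suc n) → ℕ} →
          op f ∈ ℰ → (∀ i → op (g i) ∈ ℰ) → op (substitute f g) ∈ ℰ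
  bsum  : ∀ {n} {f : Vec ℕ (suc n) → ℕ} → op f ∈ ℰ → op (boundedSum f) ∈ ℰ
  bprod : ∀ {n} {f : Vec ℕ (suc n) → ℕ} → op f ∈ ℰ → op (boundedProduct f) ∈ ℰ
  ext   : ∀ {n} {f g : Vec ℕ (suc n) → ℕ} → f ≗ g → op f ∈ ℰ → op g ∈ ℰ

{-# OPTIONS --safe #-}

-- Truncated subtraction and mod never exceed their first argument, so every
-- element of ⟨ x ∸ y , x mod y , 2^x ⟩ is bounded by a monotone function of a
-- single one of its arguments.  Addition is not.  In the other direction, mod is
-- elementary because ⌊ x / y ⌋ counts the z < x with (z + 1) y ≤ x.
module Submission where

open import Data.Fin.Base using (Fin)
open import Data.Fin.Patterns using (0F; 1F; 2F)
open import Data.List.Base using (applyUpTo)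
open import Data.Nat.Base using (ℕ; zero; suc; _+_; _*_; _∸_; _^_; _/_; _≤_; _<_; z≤n; s≤s; NonZero)
open import Data.Nat.DivMod using (/-monoˡ-≤; m*n/n≡m; m/n*n≤m; m/n≤m)
open import Data.Nat.ListAction using (sum; product)
open import Data.Nat.Properties
open import Data.Product.Base using (∃₂; _×_; _,_)
open import Data.Vec.Base using (Vec; []; _∷_; lookup; tabulate)
open import Data.Vec.Properties using (lookup∘tabulate)
open import Defs
open import Level using (0ℓ)
open import Relation.Binary.PropositionalEquality
  using (_≡_; refl; sym; trans; cong; cong₂)
open import Relation.Nullary using (yes; no)
open import Relation.Unary using (Pred; _∈_; _∉_; _⊆_; _⊂_)

sum-applyUpTo-const : ∀ c n → sum (applyUpTo (λ _ → c) n) ≡ n * c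
sum-applyUpTo-const c zero    = refl
sum-applyUpTo-const c (suc n) = cong (c +_) (sum-applyUpTo-const c n)

product-applyUpTo-const : ∀ c n → product (applyUpTo (λ _ → c) n) ≡ c ^ n
product-applyUpTo-const c zero    = refl
product-applyUpTo-const c (suc n) = cong (c *_) (product-applyUpTo-const c n)

-- The 0/1 characteristic function of a ≤ b, written with truncated subtraction alone so that it is
-- elementary by substitution.
[_≤?_] : ℕ → ℕ → ℕ
[ a ≤? b ] = 1 ∸ (a ∸ b)

[≤?]≡1 : ∀ {a b} → a ≤ b → [ a ≤? b ] ≡ 1
[≤?]≡1 a≤b = cong (1 ∸_) (m≤n⇒m∸n≡0 a≤b)

[≤?]≡0 : ∀ {a b} → b < a → [ a ≤? b ] ≡ 0
[≤?]≡0 b<a = m≤n⇒m∸n≡0 (m<n⇒0<n∸m b<a)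

-- Exactly the terms with z < q equal 1, and q ≤ n keeps them all in range. `f` is given only
-- pointwise because `applyUpTo` recurses on the shifted function z ↦ f (z + 1).
sum-[<]≡ : ∀ {f : ℕ → ℕ} q n → (∀ z → f z ≡ [ suc z ≤? q ]) → q ≤ n →
           sum (applyUpTo f n) ≡ q
sum-[<]≡ zero    zero    f≗ _         = refl
sum-[<]≡ zero    (suc n) f≗ _         =
  cong₂ _+_ (f≗ 0) (sum-[<]≡ zero n (λ z → trans (f≗ (suc z)) (sym (0∸n≡0 z))) z≤n)
sum-[<]≡ (suc q) (suc n) f≗ (s≤s q≤n) =
  cong₂ _+_ (trans (f≗ 0) (cong (1 ∸_) (0∸n≡0 q))) (sum-[<]≡ q n (λ z → f≗ (suc z)) q≤n)

-- Multiplication by y > 0 and floor division by y form a Galois connection, so the two conditions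
-- are equivalent.
[*≤?]≡[≤?/] : ∀ a x y .{{_ : NonZero y}} → [ a * y ≤? x ] ≡ [ a ≤? x / y ]
[*≤?]≡[≤?/] a x y with a ≤? x / y
... | yes a≤x/y = trans ([≤?]≡1 (≤-trans (*-monoˡ-≤ y a≤x/y) (m/n*n≤m x y))) (sym ([≤?]≡1 a≤x/y))
... | no  a≰x/y = trans ([≤?]≡0 (≰⇒> λ a*y≤x → a≰x/y (m*n≤o⇒m≤o/n a*y≤x))) (sym ([≤?]≡0 (≰⇒> a≰x/y)))
  where
  m*n≤o⇒m≤o/n : a * y ≤ x → a ≤ x / y
  m*n≤o⇒m≤o/n a*y≤x = begin
    a         ≡⟨ m*n/n≡m a y ⟨
    a * y / y ≤⟨ /-monoˡ-≤ y a*y≤x ⟩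
    x / y     ∎
    where open ≤-Reasoning

-- For y = 0 the sum is x, not x div 0 = 0, but the factor y hides this.
x∸y*sum≡x-mod-y : ∀ x y →
  x ∸ y * sum (applyUpTo (λ z → [ suc z * y ≤? x ]) x) ≡ x mod y
x∸y*sum≡x-mod-y x zero      = refl
x∸y*sum≡x-mod-y x y@(suc _) = cong (λ q → x ∸ y * q)
  (sum-[<]≡ (x / y) x (λ z → [*≤?]≡[≤?/] (suc z) x y) (m/n≤m x y))

ℰ-subst₂ : ∀ {f n} {g h : Vec ℕ (suc n) → ℕ} → binary f ∈ ℰ → op g ∈ ℰ → op h ∈ ℰ →
           op (λ xs → f (g xs) (h xs)) ∈ ℰ
ℰ-subst₂ {g = g} {h} f∈ g∈ h∈ =
  ext (λ _ → refl) (subst {g = λ { 0F → g ; 1F → h }} f∈ λ { 0F → g∈ ; 1F → h∈ })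

times∈ℰ : binary _*_ ∈ ℰ
-- The sum of the constant term x over z < y comes out as y * x, with the bound as left factor.
times∈ℰ = ext (λ { (x ∷ y ∷ []) → trans (sum-applyUpTo-const x y) (*-comm y x) })
              (bsum (proj 0F))

exp₂∈ℰ : unary (2 ^_) ∈ ℰ
exp₂∈ℰ = ext (λ { (x ∷ []) → product-applyUpTo-const 2 x }) (bprod (const 2))

mod∈ℰ : binary _mod_ ∈ ℰ
mod∈ℰ = ext (λ { (x ∷ y ∷ []) → x∸y*sum≡x-mod-y x y })
  (ℰ-subst₂ monus (proj 0F) (ℰ-subst₂ times∈ℰ (proj 1F)
    -- `bsum` makes the bound a third argument next to x and y; substituting x for it brings the sum
    -- back to two arguments.
    (subst {g = λ { 0F → λ xs → lookup xs 0F ; 1F → λ xs → lookup xs 1F ; 2F → λ xs → lookup xs 0F }}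
      (bsum summand∈ℰ)
      λ { 0F → proj 0F ; 1F → proj 1F ; 2F → proj 0F })))
  where
  summand∈ℰ : op {2} (λ xs → [ suc (lookup xs 2F) * lookup xs 1F ≤? lookup xs 0F ]) ∈ ℰ
  summand∈ℰ = ℰ-subst₂ monus (const 1) (ℰ-subst₂ monus
    (ℰ-subst₂ times∈ℰ (ℰ-subst₂ plus (const 1) (proj 2F)) (proj 1F)) (proj 0F))

⟨Monus-Mod-Exp⟩⊆ℰ : ⟨ Monus-Mod-Exp ⟩ ⊆ ℰ
⟨Monus-Mod-Exp⟩⊆ℰ (basis monus)   = monus
⟨Monus-Mod-Exp⟩⊆ℰ (basis modulo)  = mod∈ℰ
⟨Monus-Mod-Exp⟩⊆ℰ (basis exp₂)    = exp₂∈ℰ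
⟨Monus-Mod-Exp⟩⊆ℰ (const c)       = const c
⟨Monus-Mod-Exp⟩⊆ℰ (proj i)        = proj i
⟨Monus-Mod-Exp⟩⊆ℰ (subst f∈ g∈)   = subst (⟨Monus-Mod-Exp⟩⊆ℰ f∈) λ i → ⟨Monus-Mod-Exp⟩⊆ℰ (g∈ i)
⟨Monus-Mod-Exp⟩⊆ℰ (ext f≗g f∈)    = ext f≗g (⟨Monus-Mod-Exp⟩⊆ℰ f∈)

-- Monotonicity of `h` lets the property pass through substitution, where `h` meets an upper bound
-- of an inner value.
DominatedByOneArgument : Pred Operation 0ℓ
DominatedByOneArgument (op {n} f) = ∃₂ λ (i : Fin (suc n)) (h : ℕ → ℕ) →
  (∀ {a b} → a ≤ b → h a ≤ h b) × (∀ xs → f xs ≤ h (lookup xs i))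

⟨Monus-Mod-Exp⟩⊆Dominated : ⟨ Monus-Mod-Exp ⟩ ⊆ DominatedByOneArgument
⟨Monus-Mod-Exp⟩⊆Dominated (basis monus)  =
  0F , (λ a → a) , (λ a≤b → a≤b) , λ { (x ∷ y ∷ []) → m∸n≤m x y }
⟨Monus-Mod-Exp⟩⊆Dominated (basis modulo) =
  0F , (λ a → a) , (λ a≤b → a≤b) , λ { (x ∷ y ∷ []) → m∸n≤m x (y * (x div y)) }
⟨Monus-Mod-Exp⟩⊆Dominated (basis exp₂)   =
  0F , (2 ^_) , ^-monoʳ-≤ 2 , λ { (x ∷ []) → ≤-refl }
-- Arities are at least 1, so even a constant has an argument to name.
⟨Monus-Mod-Exp⟩⊆Dominated (const c)      = 0F , (λ _ → c) , (λ _ → ≤-refl) , λ _ → ≤-refl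
⟨Monus-Mod-Exp⟩⊆Dominated (proj i)       = i , (λ a → a) , (λ a≤b → a≤b) , λ _ → ≤-refl
-- If `f` is dominated through its argument `j`, the argument that dominates `g j` dominates the
-- composite.
⟨Monus-Mod-Exp⟩⊆Dominated (subst {f = f} {g} f∈ g∈) with ⟨Monus-Mod-Exp⟩⊆Dominated f∈
... | j , h , h-mono , f≤h with ⟨Monus-Mod-Exp⟩⊆Dominated (g∈ j)
... | i , k , k-mono , gⱼ≤k =
  i , (λ a → h (k a)) , (λ a≤b → h-mono (k-mono a≤b)) , λ xs → begin
    substitute f g xs                          ≤⟨ f≤h (tabulate λ l → g l xs) ⟩
    h (lookup (tabulate λ l → g l xs) j)       ≡⟨ cong h (lookup∘tabulate (λ l → g l xs) j) ⟩
    h (g j xs)                                 ≤⟨ h-mono (gⱼ≤k xs) ⟩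
    h (k (lookup xs i))                        ∎
  where open ≤-Reasoning
⟨Monus-Mod-Exp⟩⊆Dominated (ext f≗g f∈) with ⟨Monus-Mod-Exp⟩⊆Dominated f∈
... | i , h , h-mono , f≤h = i , h , h-mono , λ xs → ≤-trans (≤-reflexive (sym (f≗g xs))) (f≤h xs)

-- With the dominating argument set to 0 and the other to h 0 + 1, the sum h 0 + 1 would be at most
-- h 0.
plus∉Dominated : binary _+_ ∉ DominatedByOneArgument
plus∉Dominated (0F , h , _ , +≤h) =
  1+n≰n (≤-trans (m≤n+m (suc (h 0)) 0) (+≤h (0 ∷ suc (h 0) ∷ [])))
plus∉Dominated (1F , h , _ , +≤h) =
  1+n≰n (≤-trans (m≤m+n (suc (h 0)) 0) (+≤h (suc (h 0) ∷ 0 ∷ [])))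

corollary14 : ⟨ Monus-Mod-Exp ⟩ ⊂ ℰ
corollary14 = ⟨Monus-Mod-Exp⟩⊆ℰ , λ ℰ⊆ → plus∉Dominated (⟨Monus-Mod-Exp⟩⊆Dominated (ℰ⊆ plus))
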